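{- Let $S$ be a bounded semilattice such that the graph $G(S)$ is a path. Then either $G(S)=K_2$ or $G(S)=K_{1,2}$.
   Context: A bounded semilattice $(S,\cdot,0,1)$ is a commutative semigroup whose operation is idempotent ($x\cdot x=x$ for all $x$), with a neutral element $1$ and an absorbing element $0$ ($x\cdot 0=0$ for all $x$); it is partially ordered by $x\le y \iff x\cdot y=x$, so that $0\le x\le 1$. The graph $G(S)$ is the simple graph with vertex set $S\setminus\{0,1\}$ in which two vertices $x,y$ are adjacent iff $x\ne y$ and $x\cdot y\neq 0$. A path is a simple graph whose vertices can be arranged in a linear sequence in such a way that two vertices are adjacent if they are consecutive in the sequence, and are nonadjacent otherwise. $K_2$ is the complete graph on two vertices; $K_{1,2}$ is the complete bipartite graph with parts of sizes $1$ and $2$. Equality of graphs is meant up to isomorphism.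
   Formalization: The path (finite, as usual) is assumed to have at least two distinct vertices; without this the claim fails, since S = {0,a,1} gives the one-vertex path and S = {0,1} the empty graph, neither of which is K_2 or K_{1,2}. -}

module Defs where

open import Level using (Level; 0ℓ; _⊔_) renaming (suc to lsuc)
open import Algebra.Core using (Op₂)
open import Algebra.Definitions using (Zero)
open import Algebra.Structures using (IsIdempotentCommutativeMonoid)
open import Data.Empty using (⊥)
open import Data.Fin.Base using (Fin; toℕ)
open import Data.Nat.Base as ℕ using (ℕ)
open import Data.Product.Base using (Σ; _×_; _,_; proj₁; ∃-syntax)
open import Data.Sum.Base using (_⊎_; inj₁; inj₂)
open import Data.Unit.Base using (⊤)
open import Function.Base using (_∘_)
open import Function.Bundles using (Inverse; _⇔_)
open import Relation.Binary.Bundles using (Setoid)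
open import Relation.Binary.Core using (Rel)
open import Relation.Binary.Definitions using (Symmetric; Irreflexive; _Respects₂_)
open import Relation.Binary.PropositionalEquality
  using (_≡_; _≢_; refl; sym; setoid)
open import Relation.Nullary.Negation using (¬_)

private
  variable
    c ℓ v e a v′ e′ a′ : Level

-- 0# ≉ 1# is not required: the one-element structure is allowed.
record BoundedSemilattice c ℓ : Set (lsuc (c ⊔ ℓ)) where
  infixl 7 _∙_
  infix  4 _≈_
  field
    Carrier                       : Set c
    _≈_                           : Rel Carrier ℓ
    _∙_                           : Op₂ Carrier
    0#                            : Carrier
    1#                            : Carrier
    isIdempotentCommutativeMonoid : IsIdempotentCommutativeMonoid _≈_ _∙_ 1#
    zero                          : Zero _≈_ 0# _∙_

  open IsIdempotentCommutativeMonoid isIdempotentCommutativeMonoid public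
    renaming (refl to ≈-refl; sym to ≈-sym; trans to ≈-trans; setoid to ≈-setoid)

record SimpleGraph v e a : Set (lsuc (v ⊔ e ⊔ a)) where
  field
    vertices   : Setoid v e
  open Setoid vertices public using () renaming (Carrier to Vertex; _≈_ to _≈ᵥ_)
  field
    Adj        : Rel Vertex a
    Adj-resp   : Adj Respects₂ _≈ᵥ_
    Adj-sym    : Symmetric Adj
    Adj-irrefl : Irreflexive _≈ᵥ_ Adj

record _≅_ (G : SimpleGraph v e a) (H : SimpleGraph v′ e′ a′)
         : Set (v ⊔ e ⊔ a ⊔ v′ ⊔ e′ ⊔ a′) where
  private
    module G = SimpleGraph G
    module H = SimpleGraph H
  field
    bijection : Inverse G.vertices H.vertices
  open Inverse bijection public using (to)
  field
    adjacency : ∀ x y → G.Adj x y ⇔ H.Adj (to x) (to y)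

infix 4 _≅_

Consecutive : ∀ {n} → Rel (Fin n) 0ℓ
Consecutive i j = toℕ j ≡ ℕ.suc (toℕ i) ⊎ toℕ i ≡ ℕ.suc (toℕ j)

-- The sequence is finite; n = 0 and n = 1 are allowed here, so that the empty
-- graph and the one-vertex graph count as paths; HasTwoVertices excludes them.
record IsPath (G : SimpleGraph v e a) : Set (v ⊔ e ⊔ a) where
  open SimpleGraph G
  field
    n           : ℕ
    sequence    : Inverse (setoid (Fin n)) vertices
  open Inverse sequence public using () renaming (to to vertex)
  field
    adjacent    : ∀ i j → Consecutive i j → Adj (vertex i) (vertex j)
    nonadjacent : ∀ i j → ¬ Consecutive i j → ¬ Adj (vertex i) (vertex j)

HasTwoVertices : SimpleGraph v e a → Set (v ⊔ e)
HasTwoVertices G = ∃[ x ] ∃[ y ] ¬ (x ≈ᵥ y)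
  where open SimpleGraph G

K : ℕ → SimpleGraph 0ℓ 0ℓ 0ℓ
K n = record
  { vertices   = setoid (Fin n)
  ; Adj        = _≢_
  ; Adj-resp   = (λ { refl p → p }) , (λ { refl p → p })
  ; Adj-sym    = λ p → p ∘ sym
  ; Adj-irrefl = λ eq p → p eq
  }

OppositeParts : ∀ {m n} → Rel (Fin m ⊎ Fin n) 0ℓ
OppositeParts (inj₁ _) (inj₁ _) = ⊥
OppositeParts (inj₁ _) (inj₂ _) = ⊤
OppositeParts (inj₂ _) (inj₁ _) = ⊤
OppositeParts (inj₂ _) (inj₂ _) = ⊥

K[_,_] : ℕ → ℕ → SimpleGraph 0ℓ 0ℓ 0ℓ
K[ m , n ] = record
  { vertices   = setoid (Fin m ⊎ Fin n)
  ; Adj        = OppositeParts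
  ; Adj-resp   = (λ { refl p → p }) , (λ { refl p → p })
  ; Adj-sym    = λ {x} {y} → symmetric x y
  ; Adj-irrefl = λ {x} {y} → irreflexive x y
  }
  where
  symmetric : ∀ x y → OppositeParts {m} {n} x y → OppositeParts y x
  symmetric (inj₁ _) (inj₂ _) p = p
  symmetric (inj₂ _) (inj₁ _) p = p

  irreflexive : ∀ x y → x ≡ y → ¬ OppositeParts {m} {n} x y
  irreflexive (inj₁ _) _ refl ()
  irreflexive (inj₂ _) _ refl ()

-- Two vertices are identified when their underlying elements are; the proofs
-- of x ≉ 0# and x ≉ 1# are irrelevant.
G : BoundedSemilattice c ℓ → SimpleGraph (c ⊔ ℓ) ℓ ℓ
G S = record
  { vertices   = record
    { Carrier       = Σ Carrier λ x → ¬ (x ≈ 0#) × ¬ (x ≈ 1#)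
    ; _≈_           = λ x y → proj₁ x ≈ proj₁ y
    ; isEquivalence = record { refl = ≈-refl ; sym = ≈-sym ; trans = ≈-trans }
    }
  ; Adj        = λ x y → ¬ (proj₁ x ≈ proj₁ y) × ¬ (proj₁ x ∙ proj₁ y ≈ 0#)
  ; Adj-resp   =
      (λ y≈z (x≉y , xy≉0) →
        (λ x≈z → x≉y (≈-trans x≈z (≈-sym y≈z))) ,
        (λ xz≈0 → xy≉0 (≈-trans (∙-cong ≈-refl y≈z) xz≈0))) ,
      (λ x≈z (x≉y , xy≉0) →
        (λ z≈y → x≉y (≈-trans x≈z z≈y)) ,
        (λ zy≈0 → xy≉0 (≈-trans (∙-cong x≈z ≈-refl) zy≈0)))
  ; Adj-sym    = λ (x≉y , xy≉0) →
      (λ y≈x → x≉y (≈-sym y≈x)) ,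
      (λ yx≈0 → xy≉0 (≈-trans (comm _ _) yx≈0))
  ; Adj-irrefl = λ x≈y (x≉y , _) → x≉y x≈y
  }
  where open BoundedSemilattice S

{-# OPTIONS --safe #-}
-- If the path has at least four vertices v₀, v₁, v₂, v₃, …, then z = v₁v₂ is a
-- nonzero element below both v₁ and v₂, hence a vertex equal or adjacent to each
-- of them; no vertex is adjacent to both, so z = v₁ or z = v₂.  If z = v₁, then v₁ ≤ v₂ gives
-- v₀v₂ ≥ v₀v₁ ≠ 0; if z = v₂, then v₂ ≤ v₁ gives v₃v₁ ≥ v₃v₂ ≠ 0.
-- Both contradict nonadjacency at distance two.
module Submission where

open import Level using (Level)
open import Data.Empty using (⊥; ⊥-elim)
open import Data.Fin.Base using (Fin; suc; toℕ)
open import Data.Fin.Patterns using (0F; 1F; 2F; 3F)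
open import Data.Nat.Base as ℕ using (suc)
import Data.Nat.Properties as ℕₚ
open import Data.Product.Base using (_,_; proj₁; proj₂)
open import Data.Sum.Base using (_⊎_; inj₁; inj₂)
open import Data.Unit.Base using (tt)
open import Function.Base using (_∘_)
open import Function.Bundles using (Inverse; Equivalence; _⇔_; mk⇔; _↔_; mk↔ₛ′)
open import Function.Construct.Composition using () renaming (inverse to infixr 9 _⟨∘⟩_)
open import Function.Construct.Identity using (↔-id)
open import Function.Construct.Symmetry using () renaming (inverse to flip)
open import Relation.Binary.Bundles using (Setoid)
open import Relation.Binary.Definitions using (Decidable)
open import Relation.Binary.PropositionalEquality using (_≡_; _≢_; refl; sym; trans; setoid)
import Relation.Binary.Reasoning.Setoid as SetoidReasoning
open import Relation.Nullary.Decidable using (_⊎-dec_; decidable-stable)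
open import Relation.Nullary.Negation using (¬_)

open import Defs

private
  variable
    c ℓ v e a v′ e′ a′ : Level

consecutive? : ∀ {n} → Decidable (Consecutive {n})
consecutive? i j = (toℕ j ℕₚ.≟ ℕ.suc (toℕ i)) ⊎-dec (toℕ i ℕₚ.≟ ℕ.suc (toℕ j))

module Path {G : SimpleGraph v e a} (P : IsPath G) where
  open SimpleGraph G
  open IsPath P public
  open Inverse sequence public using () renaming (from to index)
  open Setoid vertices using () renaming (refl to ≈ᵥ-refl; sym to ≈ᵥ-sym; trans to ≈ᵥ-trans)

  vertex-index : ∀ x → vertex (index x) ≈ᵥ x
  vertex-index x = Inverse.strictlyInverseˡ sequence x

  index-injective : ∀ {x y} → index x ≡ index y → x ≈ᵥ y
  index-injective {x} {y} eq =
    ≈ᵥ-trans (≈ᵥ-sym (Inverse.inverseˡ sequence (sym eq))) (vertex-index y)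

  vertex-injective : ∀ {i j} → vertex i ≈ᵥ vertex j → i ≡ j
  vertex-injective {i} {j} eq with Inverse.inverseʳ sequence {i} (≈ᵥ-sym eq)
  ... | refl = Inverse.strictlyInverseʳ sequence j

  Adj-cong : ∀ {x x′ y y′} → x ≈ᵥ x′ → y ≈ᵥ y′ → Adj x y → Adj x′ y′
  Adj-cong x≈x′ y≈y′ = proj₂ Adj-resp x≈x′ ∘ proj₁ Adj-resp y≈y′

  Adj⇔Consecutive : ∀ x y → Adj x y ⇔ Consecutive (index x) (index y)
  Adj⇔Consecutive x y = mk⇔
    -- `nonadjacent` only refutes non-consecutiveness. Positions are numbers, so being consecutive
    -- is decidable and the double negation can be removed.
    (λ x~y → decidable-stable (consecutive? _ _) λ ¬con →
      nonadjacent _ _ ¬con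
        (Adj-cong (≈ᵥ-sym (vertex-index x)) (≈ᵥ-sym (vertex-index y)) x~y))
    (Adj-cong (vertex-index x) (vertex-index y) ∘ adjacent _ _)

  -- Replaces an arbitrary graph by the positions `Fin n`: for a concrete `n`, an isomorphism
  -- reduces to a finite check on pairs of positions.
  ≅-from-order : {H : SimpleGraph v′ e′ a′} (let module H = SimpleGraph H)
    (f : Inverse (setoid (Fin n)) H.vertices) →
    (∀ i j → Consecutive i j ⇔ H.Adj (Inverse.to f i) (Inverse.to f j)) → G ≅ H
  ≅-from-order f f-adj = record
    { bijection = flip sequence ⟨∘⟩ f
    ; adjacency = λ x y → mk⇔
        (Equivalence.to (f-adj _ _) ∘ Equivalence.to (Adj⇔Consecutive x y))
        (Equivalence.from (Adj⇔Consecutive x y) ∘ Equivalence.from (f-adj _ _))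
    }

consecutive⇔≢ : (i j : Fin 2) → Consecutive i j ⇔ i ≢ j
consecutive⇔≢ 0F 0F = mk⇔ (λ { (inj₁ ()) ; (inj₂ ()) }) λ 0≢0 → ⊥-elim (0≢0 refl)
consecutive⇔≢ 0F 1F = mk⇔ (λ _ ()) λ _ → inj₁ refl
consecutive⇔≢ 1F 0F = mk⇔ (λ _ ()) λ _ → inj₂ refl
consecutive⇔≢ 1F 1F = mk⇔ (λ { (inj₁ ()) ; (inj₂ ()) }) λ 1≢1 → ⊥-elim (1≢1 refl)

centre-ends : Fin 3 ↔ (Fin 1 ⊎ Fin 2)
centre-ends = mk↔ₛ′ to from to∘from from∘to
  where
  to : Fin 3 → Fin 1 ⊎ Fin 2
  to 0F = inj₂ 0F
  to 1F = inj₁ 0F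
  to 2F = inj₂ 1F

  from : Fin 1 ⊎ Fin 2 → Fin 3
  from (inj₁ 0F) = 1F
  from (inj₂ 0F) = 0F
  from (inj₂ 1F) = 2F

  to∘from : ∀ p → to (from p) ≡ p
  to∘from (inj₁ 0F) = refl
  to∘from (inj₂ 0F) = refl
  to∘from (inj₂ 1F) = refl

  from∘to : ∀ i → from (to i) ≡ i
  from∘to 0F = refl
  from∘to 1F = refl
  from∘to 2F = refl

-- Consecutive positions have opposite parity, and with three positions every even one is next to
-- the single odd one, `1F`. Hence parity gives the parts of `K[ 1 , 2 ]`.
consecutive⇔oppositeParts : ∀ i j →
  Consecutive i j ⇔ OppositeParts (Inverse.to centre-ends i) (Inverse.to centre-ends j)
consecutive⇔oppositeParts 0F 0F = mk⇔ (λ { (inj₁ ()) ; (inj₂ ()) }) λ ()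
consecutive⇔oppositeParts 0F 1F = mk⇔ (λ _ → tt) λ _ → inj₁ refl
consecutive⇔oppositeParts 0F 2F = mk⇔ (λ { (inj₁ ()) ; (inj₂ ()) }) λ ()
consecutive⇔oppositeParts 1F 0F = mk⇔ (λ _ → tt) λ _ → inj₂ refl
consecutive⇔oppositeParts 1F 1F = mk⇔ (λ { (inj₁ ()) ; (inj₂ ()) }) λ ()
consecutive⇔oppositeParts 1F 2F = mk⇔ (λ _ → tt) λ _ → inj₁ refl
consecutive⇔oppositeParts 2F 0F = mk⇔ (λ { (inj₁ ()) ; (inj₂ ()) }) λ ()
consecutive⇔oppositeParts 2F 1F = mk⇔ (λ _ → tt) λ _ → inj₂ refl
consecutive⇔oppositeParts 2F 2F = mk⇔ (λ { (inj₁ ()) ; (inj₂ ()) }) λ ()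

module _ (S : BoundedSemilattice c ℓ) where
  open BoundedSemilattice S
  open SimpleGraph (G S) using (Vertex; Adj; _≈ᵥ_)
  open SetoidReasoning ≈-setoid

  infix 4 _≤_
  _≤_ : Carrier → Carrier → Set ℓ
  x ≤ y = x ∙ y ≈ x

  xy≤y : ∀ x y → x ∙ y ≤ y
  xy≤y x y = begin
    x ∙ y ∙ y   ≈⟨ assoc x y y ⟩
    x ∙ (y ∙ y) ≈⟨ ∙-cong ≈-refl (idem y) ⟩
    x ∙ y       ∎

  xy≤x : ∀ x y → x ∙ y ≤ x
  xy≤x x y = begin
    x ∙ y ∙ x ≈⟨ ∙-cong (comm x y) ≈-refl ⟩
    y ∙ x ∙ x ≈⟨ xy≤y y x ⟩
    y ∙ x     ≈⟨ comm y x ⟩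
    x ∙ y     ∎

  ≤-respˡ : ∀ {x x′ y} → x ≈ x′ → x ≤ y → x′ ≤ y
  ≤-respˡ {x} {x′} {y} x≈x′ x≤y = begin
    x′ ∙ y ≈⟨ ∙-cong x≈x′ ≈-refl ⟨
    x ∙ y  ≈⟨ x≤y ⟩
    x      ≈⟨ x≈x′ ⟩
    x′     ∎

  1≤⇒≈1 : ∀ {x} → 1# ≤ x → x ≈ 1#
  1≤⇒≈1 {x} 1≤x = ≈-trans (≈-sym (identityˡ x)) 1≤x

  -- The product is the smaller element itself, which is nonzero because it is a vertex.
  ≤⇒Adj : ∀ (x y : Vertex) → ¬ (x ≈ᵥ y) → proj₁ x ≤ proj₁ y → Adj x y
  ≤⇒Adj (x , x≉0 , _) _ x≉y x≤y = x≉y , λ xy≈0 → x≉0 (≈-trans (≈-sym x≤y) xy≈0)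

  -- Since `y` is `z ∙ y`, the product `x ∙ y` is a multiple of `x ∙ z`, so it vanishes if `x ∙ z`
  -- does.
  Adj-monoʳ : ∀ (x y z : Vertex) → ¬ (x ≈ᵥ z) → proj₁ y ≤ proj₁ z → Adj x y → Adj x z
  Adj-monoʳ (x , _) (y , _) (z , _) x≉z y≤z (_ , xy≉0) = x≉z , λ xz≈0 → xy≉0 (begin
    x ∙ y       ≈⟨ ∙-cong ≈-refl (≈-trans (comm z y) y≤z) ⟨
    x ∙ (z ∙ y) ≈⟨ assoc x z y ⟨
    x ∙ z ∙ y   ≈⟨ ∙-cong xz≈0 ≈-refl ⟩
    0# ∙ y      ≈⟨ proj₁ zero y ⟩
    0#          ∎)

  -- Adjacency keeps the product away from `0#`. It lies below `x`, so if it were `1#` then `x`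
  -- would be `1#` too.
  meet : (x y : Vertex) → Adj x y → Vertex
  meet (x , _ , x≉1) (y , _) (_ , xy≉0) =
    x ∙ y , xy≉0 , λ xy≈1 → x≉1 (1≤⇒≈1 (≤-respˡ xy≈1 (xy≤x x y)))

  path-length≢4+ : ∀ m (P : IsPath (G S)) → IsPath.n P ≢ 4 ℕ.+ m
  path-length≢4+ m P@(record { n = _ }) refl =
    -- Equality in `S` need not be decidable; splitting on the position of `z` in the path replaces
    -- comparing `z` with each vertex.
    impossible (index z) (vertex-index z)
    where
    open Path P

    v₁~v₂ : Adj (vertex 1F) (vertex 2F)
    v₁~v₂ = adjacent 1F 2F (inj₁ refl)

    z : Vertex
    z = meet (vertex 1F) (vertex 2F) v₁~v₂

    z≤v₁ : proj₁ z ≤ proj₁ (vertex 1F)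
    z≤v₁ = xy≤x _ _

    z≤v₂ : proj₁ z ≤ proj₁ (vertex 2F)
    z≤v₂ = xy≤y _ _

    distinct : ∀ {i j} → i ≢ j → ¬ (vertex i ≈ᵥ vertex j)
    distinct i≢j = i≢j ∘ vertex-injective

    impossible : ∀ k → vertex k ≈ᵥ z → ⊥
    impossible 0F k≈z = nonadjacent 0F 2F (λ { (inj₁ ()) ; (inj₂ ()) })
      (≤⇒Adj (vertex 0F) (vertex 2F) (distinct λ ()) (≤-respˡ (≈-sym k≈z) z≤v₂))
    impossible 1F k≈z = nonadjacent 0F 2F (λ { (inj₁ ()) ; (inj₂ ()) })
      (Adj-monoʳ (vertex 0F) (vertex 1F) (vertex 2F) (distinct λ ())
        (≤-respˡ (≈-sym k≈z) z≤v₂) (adjacent 0F 1F (inj₁ refl)))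
    -- Mirror image of the previous case, with `3F` in the role of `0F`. This is where a fourth
    -- vertex matters: on three vertices the product may well be the end `2F`.
    impossible 2F k≈z = nonadjacent 3F 1F (λ { (inj₁ ()) ; (inj₂ ()) })
      (Adj-monoʳ (vertex 3F) (vertex 2F) (vertex 1F) (distinct λ ())
        (≤-respˡ (≈-sym k≈z) z≤v₁) (adjacent 3F 2F (inj₂ refl)))
    -- Every position from `3F` on is at distance at least two from `1F`, so one case covers them
    -- all.
    impossible k@(suc (suc (suc _))) k≈z = nonadjacent k 1F (λ { (inj₁ ()) ; (inj₂ ()) })
      (≤⇒Adj (vertex k) (vertex 1F) (distinct λ ()) (≤-respˡ (≈-sym k≈z) z≤v₁))

theorem2p10 : ∀ {c ℓ : Level} (S : BoundedSemilattice c ℓ) → IsPath (G S) → HasTwoVertices (G S) → (G S ≅ K 2) ⊎ (G S ≅ K[ 1 , 2 ])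
-- The two degenerate lengths contradict the two distinct vertices: `Fin 0` has no position for `x`,
-- and `Fin 1` forces `x` and `y` into the same one.
theorem2p10 S P@(record { n = 0 }) (x , _) with () ← Path.index P x
theorem2p10 S P@(record { n = 1 }) (x , y , x≉y)
  with Path.index P x in x↦i | Path.index P y in y↦j
... | 0F | 0F = ⊥-elim (x≉y (Path.index-injective P (trans x↦i (sym y↦j))))
theorem2p10 S P@(record { n = 2 }) _ =
  inj₁ (Path.≅-from-order P (↔-id (Fin 2)) consecutive⇔≢)
theorem2p10 S P@(record { n = 3 }) _ =
  inj₂ (Path.≅-from-order P centre-ends consecutive⇔oppositeParts)
theorem2p10 S P@(record { n = suc (suc (suc (suc m))) }) _ =
  ⊥-elim (path-length≢4+ S m P refl)
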